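{- Let $G$ be a 2-connected $o$-heavy graph on $n\geq 3$ vertices. Suppose that for every induced subgraph of $G$ isomorphic to $Z_2$, with vertices labeled $a_1,a_2,a_3,b_1,c_1$ so that its edges are $a_1a_2,a_1a_3,a_2a_3,a_1b_1,b_1c_1$, each of the pairs $\{u,v\}=\{a_2,b_1\}$ and $\{u,v\}=\{a_3,b_1\}$ satisfies $\max\{d(u),d(v)\}\geq n/2$ or $|N(u)\cap N(v)|\geq 2$. Then $G$ is Hamiltonian.
   Context: All graphs are finite and simple; $d(x)$ and $N(x)$ denote the degree and neighborhood of $x$ in $G$. A claw is $K_{1,3}$; its degree-3 vertex is the center and the other three are end-vertices. A graph $G$ on $n\geq 3$ vertices is $o$-heavy if every induced claw of $G$ has two end-vertices $x,y$ with $d(x)+d(y)\geq n$. $Z_2$ is the graph obtained from a triangle by attaching a path of length 2 to one vertex of the triangle. -}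

module Defs where

open import Data.Nat using (ℕ; zero; suc; _+_; _*_; _≥_)
open import Data.Fin using (Fin; zero; suc; inject₁; fromℕ)
open import Data.Bool using (Bool; true; false; _∧_)
open import Data.Product using (Σ; _×_; _,_)
open import Data.Sum using (_⊎_)
open import Data.Unit using (⊤)
open import Data.Empty using (⊥)
open import Relation.Binary.PropositionalEquality using (_≡_; _≢_)
open import Function.Definitions using (Injective)

record Graph (n : ℕ) : Set where
  field
    adj    : Fin n → Fin n → Bool
    sym    : ∀ x y → adj x y ≡ adj y x
    irrefl : ∀ x → adj x x ≡ false
open Graph public

module _ {n : ℕ} (G : Graph n) where

  Edge : Fin n → Fin n → Set
  Edge x y = adj G x y ≡ true

  NonEdge : Fin n → Fin n → Set
  NonEdge x y = adj G x y ≡ false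

count : ∀ {k} → (Fin k → Bool) → ℕ
count {zero}  p = 0
count {suc k} p with p zero
... | true  = suc (count (λ i → p (suc i)))
... | false = count (λ i → p (suc i))

deg : ∀ {n} → Graph n → Fin n → ℕ
deg G x = count (λ y → adj G x y)

commonNbrs : ∀ {n} → Graph n → Fin n → Fin n → ℕ
commonNbrs G u v = count (λ z → adj G u z ∧ adj G v z)

data Reach {n : ℕ} (G : Graph n) (ok : Fin n → Set) : Fin n → Fin n → Set where
  here : ∀ {x} → ok x → Reach G ok x x
  step : ∀ {x y z} → ok x → Edge G x y → Reach G ok y z → Reach G ok x z

Connected : ∀ {n} → Graph n → Set
Connected G = ∀ x y → Reach G (λ _ → ⊤) x y

TwoConnected : ∀ {n} → Graph n → Set
TwoConnected {n} G =
  (n ≥ 3) × Connected G ×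
  (∀ v x y → x ≢ v → y ≢ v → Reach G (λ z → z ≢ v) x y)

Hamiltonian : ∀ {n} → Graph n → Set
Hamiltonian {zero}  G = ⊥
Hamiltonian {suc m} G =
  Σ (Fin (suc m) → Fin (suc m)) λ σ →
    Injective _≡_ _≡_ σ ×
    (∀ (i : Fin m) → Edge G (σ (inject₁ i)) (σ (suc i))) ×
    Edge G (σ (fromℕ m)) (σ zero)

InducedClaw : ∀ {n} → Graph n → Fin n → Fin n → Fin n → Fin n → Set
InducedClaw G c x y z =
  x ≢ y × x ≢ z × y ≢ z ×
  Edge G c x × Edge G c y × Edge G c z ×
  NonEdge G x y × NonEdge G x z × NonEdge G y z

OHeavy : ∀ {n} → Graph n → Set
OHeavy {n} G = ∀ c x y z → InducedClaw G c x y z →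
  (deg G x + deg G y ≥ n) ⊎ (deg G x + deg G z ≥ n) ⊎ (deg G y + deg G z ≥ n)

InducedZ2 : ∀ {n} → Graph n → Fin n → Fin n → Fin n → Fin n → Fin n → Set
InducedZ2 G a1 a2 a3 b1 c1 =
  (a1 ≢ a2 × a1 ≢ a3 × a1 ≢ b1 × a1 ≢ c1 × a2 ≢ a3 ×
   a2 ≢ b1 × a2 ≢ c1 × a3 ≢ b1 × a3 ≢ c1 × b1 ≢ c1) ×
  (Edge G a1 a2 × Edge G a1 a3 × Edge G a2 a3 × Edge G a1 b1 × Edge G b1 c1) ×
  (NonEdge G a2 b1 × NonEdge G a3 b1 × NonEdge G a1 c1 ×
   NonEdge G a2 c1 × NonEdge G a3 c1)

-- max{d(u),d(v)} ≥ n/2  or  |N(u) ∩ N(v)| ≥ 2   (n/2 read as a rational: 2·max ≥ n)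
PairCond : ∀ {n} → Graph n → Fin n → Fin n → Set
PairCond {n} G u v =
  (2 * deg G u ≥ n) ⊎ (2 * deg G v ≥ n) ⊎ (commonNbrs G u v ≥ 2)

{-# OPTIONS --safe #-}
module Submission where

open import Defs
import Algebra.Solver.CommutativeMonoid as CommutativeMonoidSolver
open import Data.Bool using (Bool; true; false)
open import Data.Bool.Properties using (∧-comm) renaming (_≟_ to _≟ᵇ_)
open import Data.Empty using (⊥-elim)
open import Data.Fin using (Fin; zero; suc; toℕ; cast; inject₁; fromℕ)
open import Data.Fin.Properties using (_≟_; any?; all?; toℕ-injective; toℕ-cast)
open import Data.List using (List; []; _∷_; _++_; [_]; length; lookup; filter; allFin; tabulate; reverse; _ʳ++_)
open import Data.List.Membership.Propositional using (_∈_; _∉_; find)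
open import Data.List.Membership.Propositional.Properties
  using (∈-∃++; ∈-++⁻; ∈-++⁺ˡ; ∈-++⁺ʳ; ∈-allFin; ∈-filter⁺; ∈-lookup)
open import Data.List.Properties using (length-++; length-tabulate; ++-assoc; ++-identityʳ)
open import Data.List.Relation.Binary.Permutation.Propositional
  using (_↭_; ↭-refl; ↭-sym; ↭-trans; ↭⇒↭ₛ; refl; prep; swap; trans)
open import Data.List.Relation.Binary.Permutation.Propositional.Properties
  using (∈-resp-↭; ↭-length; shift; ++⁺; ++⁺ˡ; ++⁺ʳ; ++-comm; ++-commutativeMonoid; ↭-reverse)
import Data.List.Relation.Binary.Permutation.Setoid.Properties as PermSetoid
open import Data.List.Relation.Unary.All as All using (All; []; _∷_)
open import Data.List.Relation.Unary.All.Properties using (¬Any⇒All¬; All¬⇒¬Any; ¬All⇒Any¬; all-filter)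
open import Data.List.Relation.Unary.AllPairs using ([]; _∷_)
open import Data.List.Relation.Unary.Any using (here; there)
open import Data.List.Relation.Unary.Unique.Propositional using (Unique)
open import Data.List.Relation.Unary.Unique.Propositional.Properties using (allFin⁺; filter⁺)
open import Data.Nat using (ℕ; zero; suc; _+_; _*_; _≤_; _<_; _≥_; z≤n; s≤s; _≤?_)
open import Data.Nat.Properties
  using (≤-refl; ≤-reflexive; ≤-trans; ≤-antisym; ≤-total; ≤-pred; ≰⇒>; <⇒≱; <-irrefl; n≤1+n; m≤m+n; m≤n+m;
         m≤n⇒m≤1+n; +-comm; +-assoc; +-suc; +-identityʳ; +-mono-≤; +-mono-<; +-mono-<-≤; +-monoˡ-≤; +-monoʳ-≤;
         module ≤-Reasoning)
open import Data.Nat.Solver using (module +-*-Solver)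
open import Data.Product using (Σ; ∃; ∃-syntax; _×_; _,_; proj₁; proj₂)
open import Data.Sum using (_⊎_; inj₁; inj₂)
open import Data.Vec as Vec using (Vec; []; _∷_)
open import Data.Vec.Properties using (lookup∘tabulate)
open import Function.Definitions using (Injective)
open import Relation.Binary.PropositionalEquality as ≡ using (_≡_; _≢_; refl; cong; cong₂; subst; subst₂)
open import Relation.Nullary using (¬_; Dec; yes; no)
open import Relation.Nullary.Decidable using (map′; _×-dec_; _→-dec_; decidable-stable)

{-
Let y ~ z mean that yz is an edge or d(y) + d(z) ≥ n. A cycle along ~ can be rerouted along edges
without losing vertices (Bondy–Chvátal), so there is a cycle C through all heavy vertices
(2d ≥ n), and it may be taken with a vertex set that no ~-cycle strictly contains. Suppose that C is
not spanning and take an ear u, x₁, …, xₖ, v of C. Writing w⁻, w⁺ for the neighbours of w on C,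
o-heaviness and maximality give w⁻ ~ w⁺ for w = u, v, while u⁺ ≁ v⁺, u⁻ ≁ v⁻, and also u ≁ v±, v ≁ u±
when k = 1.

If some vertex of the ear after x₁ is not adjacent to u, then the Z₂ formed by {u, u⁻, u⁺} and two
consecutive ear vertices (or o-heaviness, if u⁻u⁺ is not an edge) gives d(u⁻) + d(u⁺) ≥ n; likewise
at v. Both together contradict u⁺ ≁ v⁺, u⁻ ≁ v⁻. Hence there is a triangle u, v, x with x outside C.
Let y be the last vertex of the run u⁺, …, y of neighbours of u on C. The vertex u can be moved
between y⁻ and y, keeping a ~-cycle, and the Z₂ formed by {u, v, x}, y, y⁺ shows that y is heavy.
The same at v produces a heavy y′, and y ~ y′ contradicts u⁺ ≁ v⁺ for the modified cycle.
-}

-- Lists without repetition, up to permutation.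

module _ {A : Set} where

  Unique-resp-↭ : {l m : List A} → l ↭ m → Unique l → Unique m
  Unique-resp-↭ l↭m = PermSetoid.Unique-resp-↭ (≡.setoid A) (↭⇒↭ₛ l↭m)

  Unique-∷ : ∀ {x} {l : List A} → x ∉ l → Unique l → Unique (x ∷ l)
  Unique-∷ x∉l u = ¬Any⇒All¬ _ x∉l ∷ u

  Unique-head : ∀ {x} {l : List A} → Unique (x ∷ l) → x ∉ l
  Unique-head (x≢ ∷ _) = All¬⇒¬Any x≢

  -- With `m` the list of all vertices and `l` a cycle, this lets a degree be counted on the cycle
  -- and off it separately.
  complement : ∀ {l m : List A} → Unique l → (∀ {x} → x ∈ l → x ∈ m) → ∃[ o ] l ++ o ↭ m
  complement {[]} {m} _ _ = m , ↭-refl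
  complement {x ∷ l} (x≢ ∷ ul) sub with complement ul (λ p → sub (there p))
  ... | o , lo↭m with ∈-++⁻ l (∈-resp-↭ (↭-sym lo↭m) (sub (here refl)))
  ... | inj₁ x∈l = ⊥-elim (All¬⇒¬Any x≢ x∈l)
  ... | inj₂ x∈o with ∈-∃++ x∈o
  ... | o₁ , o₂ , refl = o₁ ++ o₂ ,
        ↭-trans (prep x ↭-refl) (↭-trans (↭-sym (shift x l (o₁ ++ o₂)))
          (↭-trans (++⁺ˡ l (↭-sym (shift x o₁ o₂))) lo↭m))

-- Counting by Boolean predicates.

bit : Bool → ℕ
bit true = 1
bit false = 0

module _ {A : Set} (p : A → Bool) where

  cnt : List A → ℕ
  cnt [] = 0
  cnt (x ∷ l) = bit (p x) + cnt l

  cnt-++ : ∀ l m → cnt (l ++ m) ≡ cnt l + cnt m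
  cnt-++ [] m = refl
  cnt-++ (x ∷ l) m = ≡.trans (cong (bit (p x) +_) (cnt-++ l m)) (≡.sym (+-assoc (bit (p x)) _ _))

  cnt-↭ : ∀ {l m} → l ↭ m → cnt l ≡ cnt m
  cnt-↭ refl = refl
  cnt-↭ (prep x r) = cong (bit (p x) +_) (cnt-↭ r)
  cnt-↭ (swap {l} {m} x y r) = ≡.trans (≡.sym (+-assoc (bit (p x)) (bit (p y)) _))
    (≡.trans (cong₂ _+_ (+-comm (bit (p x)) (bit (p y))) (cnt-↭ r)) (+-assoc (bit (p y)) (bit (p x)) _))
  cnt-↭ (trans r s) = ≡.trans (cnt-↭ r) (cnt-↭ s)

count-tabulate : ∀ {A : Set} {k} (p : A → Bool) (f : Fin k → A) →
                 count (λ i → p (f i)) ≡ cnt p (tabulate f)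
count-tabulate {k = zero} p f = refl
count-tabulate {k = suc k} p f with p (f zero)
... | true = cong suc (count-tabulate p (λ i → f (suc i)))
... | false = count-tabulate p (λ i → f (suc i))

count-cong : ∀ {k} {p q : Fin k → Bool} → (∀ i → p i ≡ q i) → count p ≡ count q
count-cong {zero} p≡q = refl
count-cong {suc k} {p} {q} p≡q with p zero | q zero | p≡q zero
... | true | _ | refl = cong suc (count-cong (λ i → p≡q (suc i)))
... | false | _ | refl = count-cong (λ i → p≡q (suc i))

count-pos : ∀ {k} (p : Fin k → Bool) → 1 ≤ count p → ∃[ i ] p i ≡ true
count-pos {suc k} p c with p zero in eq
... | true = zero , eq
... | false with count-pos (λ i → p (suc i)) c
... | i , e = suc i , e

count-≢ : ∀ {k} (p : Fin k → Bool) → 2 ≤ count p → ∀ u → ∃[ i ] i ≢ u × p i ≡ true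
count-≢ {suc k} p c u with p zero in eq
count-≢ {suc k} p c zero | true with count-pos (λ i → p (suc i)) (≤-pred c)
... | i , e = suc i , (λ ()) , e
count-≢ {suc k} p c (suc u) | true = zero , (λ ()) , eq
count-≢ {suc k} p c zero | false with count-pos (λ i → p (suc i)) (≤-trans (s≤s z≤n) c)
... | i , e = suc i , (λ ()) , e
count-≢ {suc k} p c (suc u) | false with count-≢ (λ i → p (suc i)) c u
... | i , i≢u , e = suc i , (λ { refl → i≢u refl }) , e

module _ {A : Set} (f g : A → Bool) where

  cnt-disjoint : ∀ l → cnt f l + cnt g l ≤ length l ⊎ ∃[ w ] w ∈ l × f w ≡ true × g w ≡ true
  cnt-disjoint [] = inj₁ z≤n
  cnt-disjoint (x ∷ l) with cnt-disjoint l
  ... | inj₂ (w , w∈l , e) = inj₂ (w , there w∈l , e)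
  ... | inj₁ le with f x in fx | g x in gx
  ... | true | true = inj₂ (x , here refl , fx , gx)
  ... | true | false = inj₁ (s≤s le)
  ... | false | true = inj₁ (≤-trans (≤-reflexive (+-suc _ _)) (s≤s le))
  ... | false | false = inj₁ (m≤n⇒m≤1+n le)

bit≤1 : ∀ b → bit b ≤ 1
bit≤1 true = ≤-refl
bit≤1 false = z≤n

-- The inductive step of `cnt-crossing` at a link from `a` to `c`: `z`, `x`, `y` stand for the bits
-- of `f a`, `g a`, `f c`, and `x + y ≤ 1` says that this link is no crossing.
count-step : ∀ z {x y m n k} → x + y ≤ 1 → suc (m + n) ≤ y + k →
             suc (z + m + (x + n)) ≤ z + suc k
count-step z {x} {y} {m} {n} {k} x+y≤1 le = begin
  suc (z + m + (x + n))  ≡⟨ solve 4 (λ z m x n → con 1 :+ (z :+ m :+ (x :+ n)) := z :+ (x :+ (con 1 :+ (m :+ n)))) refl z m x n ⟩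
  z + (x + suc (m + n))  ≤⟨ +-monoʳ-≤ z (+-monoʳ-≤ x le) ⟩
  z + (x + (y + k))      ≡⟨ cong (z +_) (≡.sym (+-assoc x y k)) ⟩
  z + (x + y + k)        ≤⟨ +-monoʳ-≤ z (+-monoˡ-≤ k x+y≤1) ⟩
  z + suc k              ∎
  where
  open ≤-Reasoning
  open +-*-Solver

-- Segments and cycles along a relation.

data Seg {A : Set} (R : A → A → Set) : A → List A → A → Set where
  single : ∀ a → Seg R a (a ∷ []) a
  _∷_    : ∀ {a b c l} → R a b → Seg R b l c → Seg R a (a ∷ l) c

-- Lists of one or two elements can qualify, so the bound of 3 on the length is carried separately.
Cyc : {A : Set} (R : A → A → Set) → List A → Set
Cyc R l = ∃[ a ] ∃[ b ] Seg R a l b × R b a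

module _ {A : Set} {R : A → A → Set} where

  infixr 5 _++⟨_⟩_

  _++⟨_⟩_ : ∀ {a b c d l m} → Seg R a l b → R b c → Seg R c m d → Seg R a (l ++ m) d
  single a ++⟨ e ⟩ t = e ∷ t
  (e′ ∷ s) ++⟨ e ⟩ t = e′ ∷ (s ++⟨ e ⟩ t)

  start∈ : ∀ {a l b} → Seg R a l b → a ∈ l
  start∈ (single a) = here refl
  start∈ (e ∷ s) = here refl

  Seg-nonempty : ∀ {a l b} → Seg R a l b → 1 ≤ length l
  Seg-nonempty (single _) = s≤s z≤n
  Seg-nonempty (_ ∷ _) = s≤s z≤n

  Seg-head : ∀ {a b c l} → Seg R a (c ∷ l) b → a ≡ c
  Seg-head (single _) = refl
  Seg-head (_ ∷ _) = refl

  end∈ : ∀ {a l b} → Seg R a l b → b ∈ l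
  end∈ (single a) = here refl
  end∈ (e ∷ s) = there (end∈ s)

  Seg-split : ∀ {a b c m} l → Seg R a (l ++ c ∷ m) b →
              (l ≡ [] × a ≡ c ⊎ ∃[ p ] Seg R a l p × R p c) × Seg R c (c ∷ m) b
  Seg-split [] s@(single _) = inj₁ (refl , refl) , s
  Seg-split [] s@(_ ∷ _) = inj₁ (refl , refl) , s
  Seg-split (x ∷ []) (e ∷ s) with Seg-split [] s
  ... | inj₁ (_ , refl) , t = inj₂ (_ , single _ , e) , t
  Seg-split (x ∷ y ∷ l) (e ∷ s) with Seg-split (y ∷ l) s
  ... | inj₂ (p , s′ , e′) , t = inj₂ (p , e ∷ s′ , e′) , t

  module _ (sym : ∀ {x y} → R x y → R y x) where

    Seg-ʳ++ : ∀ {a b c d l m} → Seg R a l b → R a c → Seg R c m d → Seg R b (l ʳ++ m) d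
    Seg-ʳ++ (single a) e t = e ∷ t
    Seg-ʳ++ (e′ ∷ s) e t = Seg-ʳ++ s (sym e′) (e ∷ t)

    Seg-reverse : ∀ {a b l} → Seg R a l b → Seg R b (reverse l) a
    Seg-reverse (single a) = single a
    Seg-reverse (e ∷ s) = Seg-ʳ++ s (sym e) (single _)

  module _ (w : ∀ {x y} → R x y → ℕ) where

    wt : ∀ {a b l} → Seg R a l b → ℕ
    wt (single a) = 0
    wt (e ∷ s) = w e + wt s

    wt-++ : ∀ {a b c d l m} (s : Seg R a l b) (e : R b c) (t : Seg R c m d) →
            wt (s ++⟨ e ⟩ t) ≡ wt s + w e + wt t
    wt-++ (single a) e t = refl
    wt-++ (e′ ∷ s) e t = ≡.trans (cong (w e′ +_) (wt-++ s e t))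
      (solve 4 (λ x y z u → x :+ (y :+ z :+ u) := x :+ y :+ z :+ u) refl (w e′) (wt s) (w e) (wt t))
      where open +-*-Solver

    module _ (sym : ∀ {x y} → R x y → R y x) (w-sym : ∀ {x y} (e : R x y) → w (sym e) ≡ w e) where

      wt-ʳ++ : ∀ {a b c d l m} (s : Seg R a l b) (e : R a c) (t : Seg R c m d) →
               wt (Seg-ʳ++ sym s e t) ≡ wt s + w e + wt t
      wt-ʳ++ (single a) e t = refl
      wt-ʳ++ (e′ ∷ s) e t = ≡.trans (wt-ʳ++ s (sym e′) (e ∷ t))
        (≡.trans (cong (λ k → wt s + k + (w e + wt t)) (w-sym e′))
          (solve 4 (λ x y z u → y :+ x :+ (z :+ u) := x :+ y :+ z :+ u) refl (w e′) (wt s) (w e) (wt t)))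
        where open +-*-Solver

      wt-reverse : ∀ {a b l} (s : Seg R a l b) → wt (Seg-reverse sym s) ≡ wt s
      wt-reverse (single a) = refl
      wt-reverse (e ∷ s) = ≡.trans (wt-ʳ++ s (sym e) (single _))
        (≡.trans (+-identityʳ _) (≡.trans (cong (wt s +_) (w-sym e)) (+-comm (wt s) (w e))))

    module _ (f g : A → Bool) where

      -- Counting f on successors and g on predecessors leaves one slot per link of the segment,
      -- so counts that are too large meet on a link.
      cnt-crossing : ∀ {a b l} (s : Seg R a l b) → g b ≡ false →
        suc (cnt f l + cnt g l) ≤ bit (f a) + length l ⊎
        ∃[ l₁ ] ∃[ l₂ ] ∃[ p ] ∃[ q ] Σ (Seg R a l₁ p) λ s₁ → Σ (Seg R q l₂ b) λ s₂ →
          l ≡ l₁ ++ l₂ × wt s₁ + wt s₂ ≤ wt s × g p ≡ true × f q ≡ true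
      cnt-crossing (single a) gb rewrite gb = inj₁ (≤-reflexive
        (≡.trans (cong suc (≡.trans (+-identityʳ _) (+-identityʳ _))) (+-comm 1 (bit (f a)))))
      cnt-crossing {a} (_∷_ {b = c} {l = l} e s) gb with cnt-crossing s gb
      ... | inj₂ (l₁ , l₂ , p , q , s₁ , s₂ , refl , le , gp , fq) =
            inj₂ (a ∷ l₁ , l₂ , p , q , e ∷ s₁ , s₂ , refl ,
                  ≤-trans (≤-reflexive (+-assoc (w e) _ _)) (+-monoʳ-≤ (w e) le) , gp , fq)
      ... | inj₁ le with g a in ga | f c in fc
      ... | true | true = inj₂ (_ , _ , a , c , single a , s , refl , m≤n+m (wt s) (w e) , ga , fc)
      ... | true | false = inj₁ (count-step (bit (f a)) {x = 1} {y = 0} ≤-refl le)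
      ... | false | y = inj₁ (count-step (bit (f a)) {x = 0} {y = bit y} (bit≤1 y) le)

Seg-map : ∀ {A : Set} {R S : A → A → Set} → (∀ {x y} → R x y → S x y) →
          ∀ {a l b} → Seg R a l b → Seg S a l b
Seg-map f (single a) = single a
Seg-map f (e ∷ s) = f e ∷ Seg-map f s

module _ {n : ℕ} where

  complement-Fin : ∀ {l : List (Fin n)} → Unique l → ∃[ o ] l ++ o ↭ allFin n
  complement-Fin u = complement u (λ {x} _ → ∈-allFin x)

  Unique-length : ∀ {l : List (Fin n)} → Unique l → length l ≤ n
  Unique-length {l} u with complement-Fin u
  ... | o , p = ≤-trans (m≤m+n (length l) (length o))
    (≤-reflexive (≡.trans (≡.sym (length-++ l)) (≡.trans (↭-length p) (length-tabulate (λ i → i)))))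

-- Links, and the rerouting of link cycles along edges.

module _ {n : ℕ} (G : Graph n) where

  edge? : ∀ x y → Edge G x y ⊎ NonEdge G x y
  edge? x y with adj G x y
  ... | true = inj₁ refl
  ... | false = inj₂ refl

  edge-sym : ∀ {x y} → Edge G x y → Edge G y x
  edge-sym {x} {y} e = ≡.trans (sym G y x) e

  edge-nonedge : ∀ {x y} → Edge G x y → ¬ NonEdge G x y
  edge-nonedge e ne with ≡.trans (≡.sym e) ne
  ... | ()

  ¬edge : ∀ {x y} → ¬ Edge G x y → NonEdge G x y
  ¬edge {x} {y} ¬e with edge? x y
  ... | inj₁ e = ⊥-elim (¬e e)
  ... | inj₂ ne = ne

  edge-≢ : ∀ {x y} → Edge G x y → x ≢ y
  edge-≢ e refl = edge-nonedge e (irrefl G _)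

  -- Written ~ above.
  Link : Fin n → Fin n → Set
  Link x y = Edge G x y ⊎ n ≤ deg G x + deg G y

  link-sym : ∀ {x y} → Link x y → Link y x
  link-sym (inj₁ e) = inj₁ (edge-sym e)
  link-sym {x} {y} (inj₂ d) = inj₂ (subst (n ≤_) (+-comm (deg G x) (deg G y)) d)

  Heavy : Fin n → Set
  Heavy z = n ≤ 2 * deg G z

  heavy-sum : ∀ {y z} → Heavy y → Heavy z → n ≤ deg G y + deg G z
  heavy-sum {y} {z} hy hz with ≤-total (deg G y) (deg G z)
  ... | inj₁ le = ≤-trans hy (+-monoʳ-≤ (deg G y) (≤-trans (≤-reflexive (+-identityʳ _)) le))
  ... | inj₂ le = ≤-trans hz (≤-trans (≤-reflexive (cong (deg G z +_) (+-identityʳ _))) (+-monoˡ-≤ (deg G z) le))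

  badness : ∀ {x y} → Link x y → ℕ
  badness (inj₁ _) = 0
  badness (inj₂ _) = 1

  badness-sym : ∀ {x y} (e : Link x y) → badness (link-sym e) ≡ badness e
  badness-sym (inj₁ _) = refl
  badness-sym (inj₂ _) = refl

  -- The extra one in the inequality is the link cut out; it provides the strict bound that `close`
  -- asks for.
  find-bad : ∀ {a b l} (s : Seg Link a l b) → Seg (Edge G) a l b ⊎
    ∃[ l₁ ] ∃[ l₂ ] ∃[ p ] ∃[ q ] Σ (Seg Link a l₁ p) λ s₁ → Σ (Seg Link q l₂ b) λ s₂ →
      l ≡ l₁ ++ l₂ × n ≤ deg G p + deg G q × wt badness s₁ + suc (wt badness s₂) ≤ wt badness s
  find-bad (single a) = inj₁ (single a)
  find-bad {a} (inj₂ d ∷ s) = inj₂ (_ , _ , _ , _ , single a , s , refl , d , ≤-refl)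
  find-bad {a} (inj₁ e ∷ s) with find-bad s
  ... | inj₁ s′ = inj₁ (e ∷ s′)
  ... | inj₂ (l₁ , l₂ , p , q , s₁ , s₂ , eq , d , le) =
        inj₂ (a ∷ l₁ , l₂ , p , q , inj₁ e ∷ s₁ , s₂ , cong (a ∷_) eq , d , le)

  deg-cnt : ∀ x {l} → l ↭ allFin n → deg G x ≡ cnt (adj G x) l
  deg-cnt x p = ≡.trans (count-tabulate (adj G x) (λ i → i)) (≡.sym (cnt-↭ (adj G x) p))

  -- The two ends of a bad link have a common neighbour outside the cycle, or neighbours
  -- that cross inside it; both remove the bad link.
  reroute : ∀ k {a b l} (s : Seg Link a l b) (e : Link b a) → Unique l →
            wt badness s + badness e ≤ k →
            ∃[ r ] ∃[ l′ ] l′ ↭ r ++ l × Unique l′ × Cyc (Edge G) l′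
  close : ∀ k {a b l} (s : Seg Link a l b) → n ≤ deg G b + deg G a → Unique l →
          wt badness s < k →
          ∃[ r ] ∃[ l′ ] l′ ↭ r ++ l × Unique l′ × Cyc (Edge G) l′

  reroute k {a} {b} {l} s (inj₁ e) u le with find-bad s
  ... | inj₁ s′ = [] , l , ↭-refl , u , a , b , s′ , e
  -- Rotating the cycle makes the bad link from `p` to `q` the closing one.
  ... | inj₂ (l₁ , l₂ , p , q , s₁ , s₂ , refl , d , le′)
        with close k (s₂ ++⟨ inj₁ e ⟩ s₁) d (Unique-resp-↭ (++-comm l₁ l₂) u) (begin
          suc (wt badness (s₂ ++⟨ inj₁ e ⟩ s₁))       ≡⟨ cong suc (wt-++ badness s₂ (inj₁ e) s₁) ⟩
          suc (wt badness s₂ + 0 + wt badness s₁)      ≡⟨ solve 2 (λ x y → con 1 :+ (y :+ con 0 :+ x) := x :+ (con 1 :+ y) :+ con 0) refl (wt badness s₁) (wt badness s₂) ⟩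
          wt badness s₁ + suc (wt badness s₂) + 0      ≤⟨ +-monoˡ-≤ 0 le′ ⟩
          wt badness s + 0                             ≤⟨ le ⟩
          k ∎)
    where
    open ≤-Reasoning
    open +-*-Solver
  ... | r , l′ , p′ , rest = r , l′ , ↭-trans p′ (++⁺ˡ r (++-comm l₂ l₁)) , rest
  -- The bad closing link accounts for one, so the segment alone has weight below `k`.
  reroute k s (inj₂ d) u le = close k s d u (≤-trans (≤-reflexive (+-comm 1 _)) le)

  close zero s d u ()
  close (suc k) {a} {b} {l} s d u (s≤s le) with edge? b a
  ... | inj₁ e = reroute k s (inj₁ e) u (≤-trans (≤-reflexive (+-identityʳ _)) le)
  ... | inj₂ ne with complement-Fin u
  ... | o , lo↭ with cnt-disjoint (adj G a) (adj G b) o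
  ... | inj₂ (w , w∈o , aw , bw) =
        let w∉l = λ w∈l → disjoint l (Unique-resp-↭ (↭-sym lo↭) (allFin⁺ n)) w∈l w∈o
            r , l′ , p , rest = reroute k (inj₁ (edge-sym aw) ∷ s) (inj₁ bw) (Unique-∷ w∉l u)
                                  (≤-trans (≤-reflexive (+-identityʳ _)) le)
        in r ++ [ w ] , l′ , ↭-trans p (subst (r ++ w ∷ l ↭_) (≡.sym (++-assoc r [ w ] l)) ↭-refl) , rest
    where
    disjoint : ∀ (l : List (Fin n)) {o w} → Unique (l ++ o) → w ∈ l → w ∉ o
    disjoint (x ∷ l) u (here refl) w∈o = Unique-head u (∈-++⁺ʳ l w∈o)
    disjoint (x ∷ l) (_ ∷ u) (there w∈l) w∈o = disjoint l u w∈l w∈o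
  ... | inj₁ o-small with cnt-crossing badness (adj G a) (adj G b) s (irrefl G b)
  -- The new cycle goes from `a` to `p`, across to `b`, back along the second piece to `q`, and
  -- across to `a`.
  ... | inj₂ (l₁ , l₂ , p , q , s₁ , s₂ , refl , le′ , bp , aq)
        with reroute k (s₁ ++⟨ inj₁ (edge-sym bp) ⟩ Seg-reverse link-sym s₂) (inj₁ (edge-sym aq))
               (Unique-resp-↭ (++⁺ˡ l₁ (↭-sym (↭-reverse l₂))) u) (begin
          wt badness (s₁ ++⟨ inj₁ (edge-sym bp) ⟩ Seg-reverse link-sym s₂) + 0
            ≡⟨ cong (_+ 0) (wt-++ badness s₁ (inj₁ (edge-sym bp)) (Seg-reverse link-sym s₂)) ⟩
          wt badness s₁ + 0 + wt badness (Seg-reverse link-sym s₂) + 0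
            ≡⟨ cong (λ x → wt badness s₁ + 0 + x + 0) (wt-reverse badness link-sym badness-sym s₂) ⟩
          wt badness s₁ + 0 + wt badness s₂ + 0
            ≡⟨ solve 2 (λ x y → x :+ con 0 :+ y :+ con 0 := x :+ y) refl (wt badness s₁) (wt badness s₂) ⟩
          wt badness s₁ + wt badness s₂
            ≤⟨ ≤-trans le′ le ⟩
          k ∎)
    where
    open ≤-Reasoning
    open +-*-Solver
  ... | r , l′ , p′ , rest = r , l′ , ↭-trans p′ (++⁺ˡ r (++⁺ˡ l₁ (↭-reverse l₂))) , rest
  -- With neither configuration the two degrees sum to less than `n`; the count on the cycle is
  -- strict because `a` is not its own neighbour.
  close (suc k) {a} {b} {l} s d u (s≤s le) | inj₂ ne | o , lo↭ | inj₁ o-small | inj₁ l-small =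
    ⊥-elim (<-irrefl refl (begin-strict
      n ≤⟨ d ⟩
      deg G b + deg G a
        ≡⟨ cong₂ _+_ (≡.trans (deg-cnt b lo↭) (cnt-++ (adj G b) l o)) (≡.trans (deg-cnt a lo↭) (cnt-++ (adj G a) l o)) ⟩
      (cnt (adj G b) l + cnt (adj G b) o) + (cnt (adj G a) l + cnt (adj G a) o)
        ≡⟨ solve 4 (λ x y z w → (x :+ y) :+ (z :+ w) := (z :+ x) :+ (w :+ y)) refl (cnt (adj G b) l) (cnt (adj G b) o) (cnt (adj G a) l) (cnt (adj G a) o) ⟩
      (cnt (adj G a) l + cnt (adj G b) l) + (cnt (adj G a) o + cnt (adj G b) o)
        <⟨ +-mono-<-≤ (subst (λ x → suc (cnt (adj G a) l + cnt (adj G b) l) ≤ bit x + length l) (irrefl G a) l-small) o-small ⟩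
      length l + length o  ≡⟨ ≡.sym (length-++ l) ⟩
      length (l ++ o)      ≡⟨ ↭-length lo↭ ⟩
      length (allFin n)    ≡⟨ length-tabulate (λ i → i) ⟩
      n ∎))
    where
    open ≤-Reasoning
    open +-*-Solver

-- Rearrangements of a cycle with maximal vertex set.

module Maximal {n : ℕ} (G : Graph n) (o-heavy : OHeavy G)
  (z2-cond : ∀ a1 a2 a3 b1 c1 → InducedZ2 G a1 a2 a3 b1 c1 → PairCond G a2 b1 × PairCond G a3 b1)
  (C : List (Fin n)) (C! : Unique C) (3≤C : 3 ≤ length C)
  (heavy∈C : ∀ {z} → Heavy G z → z ∈ C)
  (maximal : ∀ {l} → Unique l → (∀ {z} → z ∈ C → z ∈ l) → length C < length l → ¬ Cyc (Link G) l)
  where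

  V : Set
  V = Fin n

  open import Data.List.Membership.DecPropositional (_≟_ {n}) using (_∈?_)
  open CommutativeMonoidSolver (++-commutativeMonoid {A = V}) using (solve; _⊜_; _⊕_)

  ~sym : ∀ {x y} → Edge G x y → Edge G y x
  ~sym = edge-sym G

  ⇔sym : ∀ {x y} → Link G x y → Link G y x
  ⇔sym = link-sym G

  -- The cycle u P v Q, with a = u⁺, b = v⁻, c = v⁺, d = u⁻.
  record Two (R : V → V → Set) (u : V) (P : List V) (v : V) (Q : List V) (a b c d : V) : Set where
    constructor two
    field
      segP : Seg R a P b
      segQ : Seg R c Q d
      ua : R u a
      bv : R b v
      vc : R v c
      du : R d u
      perm : u ∷ P ++ v ∷ Q ↭ C

  -- The cycle `u P`, with `a` = u⁺ and `d` = u⁻. As in `Two`, `perm` fixes only the vertex set, so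
  -- rearranged cycles on the vertices of `C` are covered too.
  record Ring (R : V → V → Set) (u : V) (P : List V) (a d : V) : Set where
    constructor ring
    field
      segP : Seg R a P d
      ua : R u a
      du : R d u
      perm : u ∷ P ↭ C

  module _ {R : V → V → Set} where

    Two⇒Ring : ∀ {u P v Q a b c d} → Two R u P v Q a b c d → Ring R u (P ++ v ∷ Q) a d
    Two⇒Ring (two P Q ua bv vc du p) = ring (P ++⟨ bv ⟩ (vc ∷ Q)) ua du p

    exchange : ∀ {u P v Q a b c d} → Two R u P v Q a b c d → Two R v Q u P c d a b
    exchange {u} {P} {v} {Q} (two sP sQ ua bv vc du p) = two sQ sP vc du ua bv
      (↭-trans (solve 4 (λ u v P Q → v ⊕ (Q ⊕ (u ⊕ P)) ⊜ u ⊕ (P ⊕ (v ⊕ Q))) refl [ u ] [ v ] P Q) p)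

    module _ (sym : ∀ {x y} → R x y → R y x) where

      Ring-mirror : ∀ {u P a d} → Ring R u P a d → Ring R u (reverse P) d a
      Ring-mirror {P = P} (ring sP ua du p) =
        ring (Seg-reverse sym sP) (sym du) (sym ua) (↭-trans (prep _ (↭-reverse P)) p)

      Two-mirror : ∀ {u P v Q a b c d} → Two R u P v Q a b c d → Two R u (reverse Q) v (reverse P) d c b a
      Two-mirror {u} {P} {v} {Q} (two sP sQ ua bv vc du p) =
        two (Seg-reverse sym sQ) (Seg-reverse sym sP) (sym du) (sym vc) (sym bv) (sym ua)
          (↭-trans (prep u (++⁺ (↭-reverse Q) (prep v (↭-reverse P))))
            (↭-trans (solve 4 (λ u v P Q → u ⊕ (Q ⊕ (v ⊕ P)) ⊜ u ⊕ (P ⊕ (v ⊕ Q))) refl [ u ] [ v ] P Q) p))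

  Two-map : ∀ {R S : V → V → Set} → (∀ {x y} → R x y → S x y) →
            ∀ {u P v Q a b c d} → Two R u P v Q a b c d → Two S u P v Q a b c d
  Two-map f (two sP sQ ua bv vc du p) = two (Seg-map f sP) (Seg-map f sQ) (f ua) (f bv) (f vc) (f du) p

  Ring-map : ∀ {R S : V → V → Set} → (∀ {x y} → R x y → S x y) →
             ∀ {u P a d} → Ring R u P a d → Ring S u P a d
  Ring-map f (ring sP ua du p) = ring (Seg-map f sP) (f ua) (f du) p

  -- The form in which maximality is used: each exclusion below exhibits a link cycle on `r ++ C`,
  -- where `r` is nonempty because it carries a segment.
  no-larger : ∀ {R p r q l} → Seg R p r q → Unique (r ++ C) → l ↭ r ++ C → ¬ Cyc (Link G) l
  no-larger {r = r} s r! p = maximal (Unique-resp-↭ (↭-sym p) r!)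
    (λ z∈C → ∈-resp-↭ (↭-sym p) (∈-++⁺ʳ r z∈C))
    (≤-trans (+-monoˡ-≤ (length C) (Seg-nonempty s)) (≤-reflexive (≡.trans (≡.sym (length-++ r)) (≡.sym (↭-length p)))))

  no-insertion : ∀ {u P a d p r q} → Ring (Link G) u P a d → Seg (Link G) p r q → Unique (r ++ C) →
                 Link G u p → ¬ Link G q a
  no-insertion {u} {P} {r = r} (ring sP ua du p) s r! up qa = no-larger s r!
    (↭-trans (↭-sym (shift u r P)) (++⁺ˡ r p)) (u , _ , up ∷ (s ++⟨ qa ⟩ sP) , du)

  -- The larger cycle would run `u`, `r`, `v`, then `P` backwards from `b` to `a`, across to `c`,
  -- and along `Q` home.
  crossing-chords : ∀ {u P v Q a b c d p r q} → Two (Link G) u P v Q a b c d →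
    Seg (Link G) p r q → Unique (r ++ C) → Link G u p → Link G q v → ¬ Link G a c
  crossing-chords {u} {P} {v} {Q} {r = r} (two sP sQ ua bv vc du p) s r! up qv ac = no-larger s r!
    (↭-trans (prep u (++⁺ˡ r (prep v (++⁺ʳ Q (↭-reverse P)))))
      (↭-trans (solve 5 (λ u v r P Q → u ⊕ (r ⊕ (v ⊕ (P ⊕ Q))) ⊜ r ⊕ (u ⊕ (P ⊕ (v ⊕ Q)))) refl [ u ] [ v ] r P Q)
        (++⁺ˡ r p)))
    (u , _ , up ∷ (s ++⟨ qv ⟩ (⇔sym bv ∷ (Seg-reverse ⇔sym sP ++⟨ ac ⟩ sQ))) , du)

  -- A vertex off the cycle and its neighbours on the cycle.

  module Outside (x : V) (x∉C : x ∉ C) where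

    x! : Unique (x ∷ C)
    x! = Unique-∷ x∉C C!

    -- Every link at a neighbour of x is then an edge, so o-heaviness applies there.
    Via : V → V → Set
    Via y z = Edge G y z ⊎ (Link G y z × ¬ Edge G x y × ¬ Edge G x z)

    Via-sym : ∀ {y z} → Via y z → Via z y
    Via-sym (inj₁ e) = inj₁ (~sym e)
    Via-sym (inj₂ (l , ¬y , ¬z)) = inj₂ (⇔sym l , ¬z , ¬y)

    Via⇒Link : ∀ {y z} → Via y z → Link G y z
    Via⇒Link (inj₁ e) = inj₁ e
    Via⇒Link (inj₂ (l , _)) = l

    Via⇒Edge : ∀ {y z} → Edge G x y → Via y z → Edge G y z
    Via⇒Edge xy (inj₁ e) = e
    Via⇒Edge xy (inj₂ (_ , ¬xy , _)) = ⊥-elim (¬xy xy)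

    x≢ : ∀ {y} → y ∈ C → y ≢ x
    x≢ y∈C refl = x∉C y∈C

    no-link-next : ∀ {u P a d} → Ring Via u P a d → Edge G x u → ¬ Link G x a
    no-link-next R xu = no-insertion (Ring-map Via⇒Link R) (single x) x! (inj₁ (~sym xu))

    no-link-prev : ∀ {u P a d} → Ring Via u P a d → Edge G x u → ¬ Link G x d
    no-link-prev R = no-link-next (Ring-mirror Via-sym R)

    ends-≢ : ∀ {u P a d} → Ring Via u P a d → a ≢ d
    ends-≢ (ring (single a) ua du p) _ with subst (3 ≤_) (≡.sym (↭-length p)) 3≤C
    ... | s≤s (s≤s ())
    ends-≢ {P = a ∷ P} (ring (_ ∷ s) ua du p) refl with Unique-resp-↭ (↭-sym p) C!
    ... | _ ∷ P! = Unique-head P! (end∈ s)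

    ends∈C : ∀ {u P a d} → Ring Via u P a d → a ∈ C × d ∈ C
    ends∈C (ring s _ _ p) = ∈-resp-↭ p (there (start∈ s)) , ∈-resp-↭ p (there (end∈ s))

    -- If u⁻u⁺ is not an edge, then u⁻, u⁺, `x` are the ends of a claw at `u`. A large degree sum
    -- involving `x` would link it to u⁻ or u⁺ and allow its insertion, so the large sum is that of
    -- u⁻ and u⁺. The link lets a cycle bypass `u`.
    skip : ∀ {u P a d} → Ring Via u P a d → Edge G x u → Link G d a
    skip {u} {P} {a} {d} R xu with edge? G d a
    ... | inj₁ e = inj₁ e
    ... | inj₂ ne with o-heavy u d a x
            ((λ e → ends-≢ R (≡.sym e)) , x≢ (proj₂ (ends∈C R)) , x≢ (proj₁ (ends∈C R)) ,
             Via⇒Edge xu (Via-sym (Ring.du R)) , Via⇒Edge xu (Ring.ua R) , ~sym xu ,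
             ne , ¬edge G (λ e → no-link-prev R xu (inj₁ (~sym e))) ,
             ¬edge G (λ e → no-link-next R xu (inj₁ (~sym e))))
    ... | inj₁ da = inj₂ da
    ... | inj₂ (inj₁ dx) = ⊥-elim (no-link-prev R xu (⇔sym (inj₂ dx)))
    ... | inj₂ (inj₂ ax) = ⊥-elim (no-link-next R xu (⇔sym (inj₂ ax)))

    -- If `v` were next to `u` on the cycle, `x` would fit between them; hence both arcs are
    -- nonempty.
    Ring⇒Two : ∀ {u v a d} P Q → Ring Via u (P ++ v ∷ Q) a d → Edge G x u → Edge G x v →
               ∃[ b ] ∃[ c ] Two Via u P v Q a b c d
    Ring⇒Two P Q R@(ring s ua du p) xu xv with Seg-split P s
    ... | inj₁ (refl , refl) , _ = ⊥-elim (no-link-next R xu (inj₁ xv))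
    ... | inj₂ _ , single _ = ⊥-elim (no-link-prev R xu (inj₁ xv))
    ... | inj₂ (b , sP , bv) , vc ∷ sQ = b , _ , two sP sQ ua bv vc du p

    -- The larger cycle would run `u`, `x`, `v`, then `P` from `a` to `b`, bypass the old place of
    -- `v` by the link from `b` to `c`, and follow `Q` home.
    no-far-link : ∀ {u P v Q a b c d} → Two Via u P v Q a b c d → Edge G x u → Edge G x v → ¬ Link G v a
    no-far-link {u} {P} {v} {Q} T xu xv va = no-larger (single {R = Link G} x) x!
      (↭-trans (solve 5 (λ u v x P Q → u ⊕ (x ⊕ (v ⊕ (P ⊕ Q))) ⊜ x ⊕ (u ⊕ (P ⊕ (v ⊕ Q)))) refl [ u ] [ v ] [ x ] P Q)
        (prep x perm))
      (u , _ , inj₁ (~sym xu) ∷ (inj₁ xv ∷ (va ∷ (segP ++⟨ skip (Two⇒Ring (exchange T)) xv ⟩ segQ))) , du)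
      where open Two (Two-map Via⇒Link T)

    -- Off the cycle, `x` and `w` together could be inserted between `u` and `a`; on it,
    -- `no-far-link` applies with `w` as `v`.
    no-common : ∀ {u P a d w} → Ring Via u P a d → Edge G x u → Edge G x w → w ≢ u → ¬ Edge G w a
    no-common {u} {P} {w = w} R xu xw w≢u wa with w ∈? C
    ... | no w∉C = no-insertion (Ring-map Via⇒Link R) (inj₁ xw ∷ single w)
            (Unique-∷ (λ { (here e) → edge-≢ G xw e ; (there p) → x∉C p }) (Unique-∷ w∉C C!))
            (inj₁ (~sym xu)) (inj₁ wa)
    ... | yes w∈C with ∈-resp-↭ (↭-sym (Ring.perm R)) w∈C
    ... | here e = w≢u e
    ... | there w∈P with ∈-∃++ w∈P
    ... | P₁ , P₂ , refl with Ring⇒Two P₁ P₂ R xu xw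
    ... | b , c , T = no-far-link T xu xw (inj₁ wa)

    -- The pair condition on {a, x} leaves only the possibility that a is heavy.
    next-heavy : ∀ {u P a d} → Ring Via u P a d → Edge G x u → PairCond G a x → Heavy G a
    next-heavy R xu (inj₁ h) = h
    next-heavy R xu (inj₂ (inj₁ h)) = ⊥-elim (x∉C (heavy∈C h))
    next-heavy {u} {a = a} R xu (inj₂ (inj₂ two-common)) with count-≢ _ two-common u
    ... | w , w≢u , e with adj G a w in aw | adj G x w in xw | e
    ... | true | true | _ = ⊥-elim (no-common R xu xw w≢u (~sym aw))
    ... | true | false | ()
    ... | false | _ | ()

    -- If u⁻u⁺ is an edge, the triangle on `u`, u⁺, u⁻ with the tail `x`, `y` is an induced Z₂, and
    -- its two pair conditions make u⁺ and u⁻ heavy. The vertex `y` may lie on or off the cycle.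
    neighbours-sum : ∀ {u P a d y} → Ring Via u P a d → Edge G x u → Edge G x y → y ≢ u → NonEdge G y u →
                     n ≤ deg G d + deg G a
    neighbours-sum {u} {P} {a} {d} {y} R xu xy y≢u yu with skip R xu
    ... | inj₂ da = da
    ... | inj₁ da = heavy-sum G (next-heavy (Ring-mirror Via-sym R) xu (proj₂ pairs))
                                (next-heavy R xu (proj₁ pairs))
      where
      ¬xa : ¬ Edge G x a
      ¬xa e = no-link-next R xu (inj₁ e)
      ¬xd : ¬ Edge G x d
      ¬xd e = no-link-prev R xu (inj₁ e)
      ud : Edge G u d
      ud = Via⇒Edge xu (Via-sym (Ring.du R))
      ua : Edge G u a
      ua = Via⇒Edge xu (Ring.ua R)
      pairs : PairCond G a x × PairCond G d x
      pairs = z2-cond u a d x y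
        ((edge-≢ G ua , edge-≢ G ud , edge-≢ G (~sym xu) , (λ e → y≢u (≡.sym e)) , ends-≢ R ,
          x≢ (proj₁ (ends∈C R)) , (λ { refl → ¬xa xy }) , x≢ (proj₂ (ends∈C R)) ,
          (λ { refl → ¬xd xy }) , edge-≢ G xy) ,
         (ua , ud , ~sym da , ~sym xu , xy) ,
         (¬edge G (λ e → ¬xa (~sym e)) , ¬edge G (λ e → ¬xd (~sym e)) , ≡.trans (sym G u y) yu ,
          ¬edge G (λ e → no-common R xu xy y≢u (~sym e)) ,
          ¬edge G (λ e → no-common (Ring-mirror Via-sym R) xu xy y≢u (~sym e))))

    -- The larger cycle would be `u`, `x`, `T`, `v`, `Q`, `a`, with `skip` linking `d` to `a`.
    no-second-edge : ∀ {u T v Q a a₂ b c d} → Two Via u (a ∷ T) v Q a b c d → Seg Via a₂ T b →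
                     Edge G x u → ¬ Edge G x a₂
    no-second-edge {u} {T} {v} {Q} {a} W s xu xa₂ = no-larger (single {R = Link G} x) x!
      (↭-trans (solve 6 (λ u v x a T Q → u ⊕ (x ⊕ (T ⊕ (v ⊕ (Q ⊕ a)))) ⊜ x ⊕ (u ⊕ (a ⊕ (T ⊕ (v ⊕ Q))))) refl [ u ] [ v ] [ x ] [ a ] T Q)
        (prep x perm))
      (u , a , inj₁ (~sym xu) ∷ (inj₁ xa₂ ∷ (Seg-map Via⇒Link s ++⟨ bv ⟩
                 (vc ∷ (segQ ++⟨ skip (Two⇒Ring W) xu ⟩ single a)))) , ⇔sym ua)
      where open Two (Two-map Via⇒Link W)

    -- The larger cycle would be `u`, `a`, `Q` backwards, `T` backwards, `v`, `x`, bypassing the old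
    -- places of `u` and `v`.
    no-second-chord : ∀ {u T v Q a a₂ b c d} → Two Via u (a ∷ T) v Q a b c d → Seg Via a₂ T b →
                      Edge G x u → Edge G x v → ¬ Edge G v a₂
    no-second-chord {u} {T} {v} {Q} {a} W s xu xv va₂ = no-larger (single {R = Link G} x) x!
      (↭-trans (prep u (prep a (++⁺ (↭-reverse Q) (++⁺ʳ (v ∷ x ∷ []) (↭-reverse T)))))
        (↭-trans (solve 6 (λ u v x a T Q → u ⊕ (a ⊕ (Q ⊕ (T ⊕ (v ⊕ x)))) ⊜ x ⊕ (u ⊕ (a ⊕ (T ⊕ (v ⊕ Q))))) refl [ u ] [ v ] [ x ] [ a ] T Q)
          (prep x perm)))
      (u , x , ua ∷ (⇔sym (skip (Two⇒Ring W) xu) ∷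
                 (Seg-reverse ⇔sym segQ ++⟨ ⇔sym (skip (Two⇒Ring (exchange W)) xv) ⟩
                 (Seg-reverse ⇔sym (Seg-map Via⇒Link s) ++⟨ inj₁ (~sym va₂) ⟩ (inj₁ (~sym xv) ∷ single x)))) ,
       inj₁ xu)
      where open Two (Two-map Via⇒Link W)

    -- Moves `u` between `a` and `a₂`. The gap left behind is closed by `skip`, and neither end of
    -- that link is adjacent to `x`, so `Via` survives.
    move : ∀ {u T v Q a a₂ b c d} → Two Via u (a ∷ T) v Q a b c d → Seg Via a₂ T b →
           Edge G x u → Edge G u a₂ → Two Via u T v (Q ++ [ a ]) a₂ b c a
    move {u} {T} {v} {Q} {a} W s xu ua₂ = two s
      (segQ ++⟨ inj₂ (skip R xu , (λ e → no-link-prev R xu (inj₁ e)) , (λ e → no-link-next R xu (inj₁ e))) ⟩ single a)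
      (inj₁ ua₂) bv vc (Via-sym ua)
      (↭-trans (solve 5 (λ u v a T Q → u ⊕ (T ⊕ (v ⊕ (Q ⊕ a))) ⊜ u ⊕ (a ⊕ (T ⊕ (v ⊕ Q)))) refl [ u ] [ v ] [ a ] T Q) perm)
      where
      open Two W
      R = Two⇒Ring W

    -- Two segments along different relations share their second vertex, since it is read off the
    -- common list.
    second : ∀ {R S : V → V → Set} {y a c b e l m} → Seg R a (y ∷ l ++ m) b → Seg S c l e → Seg R c (l ++ m) b
    second (_ ∷ s) (single _) = subst (λ z → Seg _ z _ _) (Seg-head s) s
    second (_ ∷ s) (_ ∷ _) = subst (λ z → Seg _ z _ _) (Seg-head s) s

    -- `S` is the stretch whose links are known to be edges, as a Z₂ requires; `T` holds vertices
    -- appended by earlier moves. The walk along `S` stops because its last vertex is not adjacent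
    -- to `u`.
    make-heavy : ∀ {u v Q a b c d s S} T → Seg (Edge G) a S s → NonEdge G u s →
                 Edge G x u → Edge G x v → Edge G u v → Two Via u (S ++ T) v Q a b c d →
                 ∃[ P′ ] ∃[ T′ ] ∃[ a′ ] ∃[ d′ ] Two Via u P′ v (Q ++ T′) a′ b c d′ × Heavy G a′
    make-heavy T (single a) us xu xv uv W = ⊥-elim (edge-nonedge G (Via⇒Edge xu (Two.ua W)) us)
    make-heavy {u} {v} {Q} {a} T (_∷_ {b = a₂} {l = S} e sS) us xu xv uv W with second {m = T} (Two.segP W) sS
    ... | s with edge? G u a₂
    ... | inj₁ ua₂ with make-heavy T sS us xu xv uv (move W s xu ua₂)
    ... | P′ , T′ , a′ , d′ , W′ , h =
          P′ , a ∷ T′ , a′ , d′ , subst (λ Q′ → Two Via u P′ v Q′ a′ _ _ d′) (++-assoc Q [ a ] T′) W′ , h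
    -- The run of neighbours of `u` ends at `a`: the triangle `u`, `v`, `x` with the tail `a`, `a₂`
    -- is an induced Z₂, and the pair `x`, `a` is used.
    make-heavy {u} {v} {Q} {a} T (_∷_ {b = a₂} {l = S} e sS) us xu xv uv W | s | inj₂ ua₂ =
      _ , [] , a , _ , subst (λ Q′ → Two Via u _ v Q′ a _ _ _) (≡.sym (++-identityʳ Q)) W ,
      next-heavy R xu (PairCond-sym x a (proj₂ (z2-cond u v x a a₂
        ((edge-≢ G uv , edge-≢ G (~sym xu) , edge-≢ G ua , (λ { refl → ¬xa₂ xu }) , edge-≢ G (~sym xv) ,
          (λ { refl → ¬xa xv }) , (λ { refl → ¬xa₂ xv }) , (λ e → x≢ (proj₁ (ends∈C R)) (≡.sym e)) ,
          (λ e → x≢ (∈-resp-↭ perm (there (there (∈-++⁺ˡ (start∈ s))))) (≡.sym e)) , edge-≢ G e) ,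
         (uv , ~sym xu , ~sym xv , ua , e) ,
         (¬edge G (λ va → no-far-link W xu xv (inj₁ va)) , ¬edge G ¬xa , ua₂ ,
          ¬edge G (no-second-chord W s xu xv) , ¬edge G ¬xa₂)))))
      where
      open Two W using (perm)
      R = Two⇒Ring W
      ua : Edge G u a
      ua = Via⇒Edge xu (Two.ua W)
      ¬xa : ¬ Edge G x a
      ¬xa e = no-link-next R xu (inj₁ e)
      ¬xa₂ : ¬ Edge G x a₂
      ¬xa₂ = no-second-edge W s xu
      PairCond-sym : ∀ y z → PairCond G y z → PairCond G z y
      PairCond-sym y z (inj₁ h) = inj₂ (inj₁ h)
      PairCond-sym y z (inj₂ (inj₁ h)) = inj₁ h
      PairCond-sym y z (inj₂ (inj₂ h)) =
        inj₂ (inj₂ (subst (2 ≤_) (count-cong (λ w → ∧-comm (adj G y w) (adj G z w))) h))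

    no-triangle : ∀ {u P v Q a b c d} → Two (Edge G) u P v Q a b c d →
                  Edge G x u → Edge G x v → ¬ Edge G u v
    no-triangle {u} {P} {v} {Q} {a} {b} {c} {d} T xu xv uv
      with make-heavy [] (Two.segP T) u≁b xu xv uv (subst (λ P → Two Via u P v Q a b c d) (≡.sym (++-identityʳ P)) W)
      where
      W = Two-map inj₁ T
      u≁b = ¬edge G (λ ub → no-far-link (exchange (Two-mirror Via-sym W)) xv xu (inj₁ ub))
    ... | P′ , T′ , a′ , d′ , W₁ , heavy-a′
      with make-heavy T′ (Two.segP (exchange T)) v≁d xv xu (~sym uv) (exchange W₁)
      where
      v≁d = ¬edge G (λ vd → no-far-link (Two-mirror Via-sym (Two-map inj₁ T)) xu xv (inj₁ vd))
    -- The moves of `v` have kept `a′` as u⁺, so the heavy vertices `a′` and `c′` give the forbidden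
    -- link.
    ... | _ , _ , c′ , _ , W₂ , heavy-c′ =
      crossing-chords (Two-map Via⇒Link W₂) (single x) x! (inj₁ (~sym xv)) (inj₁ xu)
        (inj₂ (heavy-sum G heavy-c′ heavy-a′))

  -- Exclusion of ears.

  rotate : ∀ {u} → Cyc (Edge G) C → u ∈ C → ∃[ P ] ∃[ a ] ∃[ d ] Ring (Edge G) u P a d
  rotate {u} (a , b , s , ba) u∈C with ∈-∃++ u∈C
  ... | l₁ , l₂ , eq with Seg-split l₁ (subst (λ l → Seg (Edge G) a l b) eq s)
  ... | inj₁ (refl , refl) , single _ = ⊥-elim (edge-≢ G ba refl)
  ... | inj₁ (refl , refl) , ua ∷ s₂ = l₂ , _ , b , ring s₂ ua ba (subst (u ∷ l₂ ↭_) (≡.sym eq) ↭-refl)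
  ... | inj₂ (p , s₁ , pu) , single _ = l₁ , a , p , ring s₁ ba pu
        (subst (u ∷ l₁ ↭_) (≡.sym eq) (++-comm [ u ] l₁))
  ... | inj₂ (p , s₁ , pu) , ua ∷ s₂ = l₂ ++ l₁ , _ , p , ring (s₂ ++⟨ ba ⟩ s₁) ua pu
        (subst (u ∷ l₂ ++ l₁ ↭_) (≡.sym eq) (++-comm (u ∷ l₂) l₁))

  -- Follows the ear while its vertices are adjacent to `u`. If even `v` is, then `q` closes a
  -- triangle with `u` and `v`; otherwise the first failure `y`, possibly `v` itself, has a
  -- predecessor `x` adjacent to `u`.
  scan : ∀ {p r q u v} → Seg (Edge G) p r q → (∀ {z} → z ∈ r → z ≢ u) → Edge G p u → Edge G q v → v ≢ u →
         Edge G q u × Edge G u v ⊎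
         ∃[ x ] ∃[ y ] x ∈ r × Edge G x u × Edge G x y × y ≢ u × NonEdge G y u
  scan {u = u} {v} (single q) r≢u pu qv v≢u with edge? G v u
  ... | inj₁ vu = inj₁ (pu , ~sym vu)
  ... | inj₂ v≁u = inj₂ (q , v , here refl , pu , qv , v≢u , v≁u)
  scan {u = u} (_∷_ {a = p} {b = y} e s) r≢u pu qv v≢u with edge? G y u
  ... | inj₂ y≁u = inj₂ (p , y , here refl , pu , e , r≢u (there (start∈ s)) , y≁u)
  ... | inj₁ yu with scan s (λ z∈ → r≢u (there z∈)) yu qv v≢u
  ... | inj₁ found = inj₁ found
  ... | inj₂ (x , z , x∈ , rest) = inj₂ (x , z , there x∈ , rest)

  no-ear : ∀ {u v p r q} → Cyc (Edge G) C → u ∈ C → v ∈ C → v ≢ u →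
           Seg (Edge G) p r q → Unique (r ++ C) → (∀ {z} → z ∈ r → z ∉ C) →
           Edge G u p → ¬ Edge G q v
  no-ear {u} {v} {p} {r} {q} cyc u∈C v∈C v≢u s r! r∉C up qv with rotate cyc u∈C
  ... | P , a , d , R with ∈-resp-↭ (↭-sym (Ring.perm R)) v∈C
  ... | here v≡u = v≢u v≡u
  ... | there v∈P with ∈-∃++ v∈P
  ... | P , Q , refl with Seg-split P (Ring.segP R)
  ... | inj₁ (refl , refl) , _ = no-insertion (Ring-map inj₁ R) (Seg-map inj₁ s) r! (inj₁ up) (inj₁ qv)
  ... | inj₂ _ , single _ = no-insertion (Ring-mirror ⇔sym (Ring-map inj₁ R)) (Seg-map inj₁ s) r! (inj₁ up) (inj₁ qv)
  -- The ear is scanned from `u` and its reverse from `v`.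
  ... | inj₂ (b , sP , bv) , (_∷_ {b = c} vc sQ)
        with scan s (λ { z∈r refl → r∉C z∈r u∈C }) (~sym up) qv v≢u
           | scan (Seg-reverse ~sym s) (λ { z∈r refl → r∉C (∈-resp-↭ (↭-reverse r) z∈r) v∈C }) qv (~sym up) (λ e → v≢u (≡.sym e))
  ... | inj₁ (qu , uv) | _ = Outside.no-triangle q (r∉C (end∈ s)) (two sP sQ (Ring.ua R) bv vc (Ring.du R) (Ring.perm R)) qu qv uv
  ... | inj₂ _ | inj₁ (pv , vu) = Outside.no-triangle p (r∉C (start∈ s)) (two sP sQ (Ring.ua R) bv vc (Ring.du R) (Ring.perm R)) (~sym up) pv (~sym vu)
  ... | inj₂ (x , y , x∈r , xu , xy , y≢u , y≁u) | inj₂ (x′ , y′ , x′∈r , x′v , x′y′ , y′≢v , y′≁v)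
        with n ≤? deg G a + deg G c | n ≤? deg G d + deg G b
  ... | yes ac | _ = crossing-chords (Two-map inj₁ T) (Seg-map inj₁ s) r! (inj₁ up) (inj₁ qv) (inj₂ ac)
    where T = two sP sQ (Ring.ua R) bv vc (Ring.du R) (Ring.perm R)
  ... | no _ | yes db = crossing-chords (Two-mirror ⇔sym (Two-map inj₁ T)) (Seg-map inj₁ s) r! (inj₁ up) (inj₁ qv) (inj₂ db)
    where T = two sP sQ (Ring.ua R) bv vc (Ring.du R) (Ring.perm R)
  ... | no ¬ac | no ¬db = <-irrefl refl (begin-strict
      n + n
        ≤⟨ +-mono-≤ (Outside.neighbours-sum x (r∉C x∈r) (Ring-map inj₁ (Two⇒Ring T)) xu xy y≢u y≁u)
                    (Outside.neighbours-sum x′ (r∉C (∈-resp-↭ (↭-reverse r) x′∈r)) (Ring-map inj₁ (Two⇒Ring (exchange T))) x′v x′y′ y′≢v y′≁v) ⟩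
      (deg G d + deg G a) + (deg G b + deg G c)
        ≡⟨ N.solve 4 (λ a b c d → (d N.:+ a) N.:+ (b N.:+ c) N.:= (a N.:+ c) N.:+ (d N.:+ b)) refl (deg G a) (deg G b) (deg G c) (deg G d) ⟩
      (deg G a + deg G c) + (deg G d + deg G b)
        <⟨ +-mono-< (≰⇒> ¬ac) (≰⇒> ¬db) ⟩
      n + n ∎)
    where
    open ≤-Reasoning
    module N = +-*-Solver
    T = two sP sQ (Ring.ua R) bv vc (Ring.du R) (Ring.perm R)

-- Spanning cycles as Hamiltonian cycles, and decidability.

lookup-injective : ∀ {A : Set} {l : List A} → Unique l → ∀ {i j} → lookup l i ≡ lookup l j → i ≡ j
lookup-injective {l = x ∷ l} u {zero} {zero} e = refl
lookup-injective {l = x ∷ l} u {zero} {suc j} e = ⊥-elim (Unique-head u (subst (_∈ l) (≡.sym e) (∈-lookup j)))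
lookup-injective {l = x ∷ l} u {suc i} {zero} e = ⊥-elim (Unique-head u (subst (_∈ l) e (∈-lookup i)))
lookup-injective {l = x ∷ l} (_ ∷ u) {suc i} {suc j} e = cong suc (lookup-injective u e)

Seg-step : ∀ {A : Set} {R : A → A → Set} {a l b m} → Seg R a l b → (eq : suc m ≡ length l) (i : Fin m) →
           R (lookup l (cast eq (inject₁ i))) (lookup l (cast eq (suc i)))
Seg-step (single a) refl ()
Seg-step (e ∷ s@(single _)) refl zero = e
Seg-step (e ∷ s@(_ ∷ _)) refl zero = e
Seg-step (e ∷ s@(single _)) refl (suc ())
Seg-step (e ∷ s@(_ ∷ _)) refl (suc i) = Seg-step s refl i

Seg-first : ∀ {A : Set} {R : A → A → Set} {a l b m} → Seg R a l b → (eq : suc m ≡ length l) →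
            lookup l (cast eq zero) ≡ a
Seg-first (single a) refl = refl
Seg-first (e ∷ s) refl = refl

Seg-last : ∀ {A : Set} {R : A → A → Set} {a l b m} → Seg R a l b → (eq : suc m ≡ length l) →
           lookup l (cast eq (fromℕ m)) ≡ b
Seg-last (single a) refl = refl
Seg-last (e ∷ s@(single _)) refl = refl
Seg-last (e ∷ s@(_ ∷ _)) refl = Seg-last s refl

IsHamCycle : ∀ {m} → Graph (suc m) → (Fin (suc m) → Fin (suc m)) → Set
IsHamCycle {m} G σ = Injective _≡_ _≡_ σ ×
  (∀ (i : Fin m) → Edge G (σ (inject₁ i)) (σ (suc i))) × Edge G (σ (fromℕ m)) (σ zero)

any-Vec? : ∀ {n} k {P : Vec (Fin n) k → Set} → (∀ v → Dec (P v)) → Dec (∃ P)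
any-Vec? zero P? = map′ (λ p → [] , p) (λ { ([] , p) → p }) (P? [])
any-Vec? (suc k) P? = map′ (λ { (i , v , p) → i ∷ v , p }) (λ { (i ∷ v , p) → i , v , p })
  (any? (λ i → any-Vec? k (λ v → P? (i ∷ v))))

-- Removes the double negation produced by `extend`. The search runs over vectors, since a function
-- agrees pointwise with its tabulation.
hamiltonian? : ∀ {n} (G : Graph n) → Dec (Hamiltonian G)
hamiltonian? {zero} G = no (λ ())
hamiltonian? {suc m} G = map′ (λ { (v , h) → Vec.lookup v , h })
  (λ { (σ , h) → Vec.tabulate σ , resp (λ i → ≡.sym (lookup∘tabulate σ i)) h })
  (any-Vec? (suc m) {λ v → IsHamCycle G (Vec.lookup v)} (λ v → dec (Vec.lookup v)))
  where
  resp : ∀ {σ τ} → (∀ i → σ i ≡ τ i) → IsHamCycle {m} G σ → IsHamCycle G τ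
  resp {σ} {τ} σ≗τ (inj , edges , closing) =
    (λ {i} {j} e → inj (≡.trans (σ≗τ i) (≡.trans e (≡.sym (σ≗τ j))))) ,
    (λ i → subst₂ (Edge G) (σ≗τ _) (σ≗τ _) (edges i)) , subst₂ (Edge G) (σ≗τ _) (σ≗τ _) closing
  dec : ∀ σ → Dec (IsHamCycle G σ)
  dec σ = map′ (λ f {x} {y} → f x y) (λ f x y → f {x} {y})
            (all? (λ x → all? (λ y → (σ x ≟ σ y) →-dec (x ≟ y))))
          ×-dec (all? (λ i → adj G (σ (inject₁ i)) (σ (suc i)) ≟ᵇ true)
          ×-dec (adj G (σ (fromℕ m)) (σ zero) ≟ᵇ true))

spanning⇒hamiltonian : ∀ {n} (G : Graph n) {l} → Unique l → n ≤ length l → Cyc (Edge G) l → Hamiltonian G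
spanning⇒hamiltonian {zero} G u le (() , _)
spanning⇒hamiltonian {suc m} G {l} u le (a , b , s , ba) =
  (λ i → lookup l (cast eq i)) ,
  (λ {i} {j} e → toℕ-injective (≡.trans (≡.sym (toℕ-cast eq i))
     (≡.trans (cong toℕ (lookup-injective u e)) (toℕ-cast eq j)))) ,
  Seg-step s eq , subst₂ (Edge G) (≡.sym (Seg-last s eq)) (≡.sym (Seg-first s eq)) ba
  where eq = ≤-antisym le (Unique-length u)

-- Fresh vertices, simple paths, and leaving or entering a set.

module _ {n : ℕ} where

  open import Data.List.Membership.DecPropositional (_≟_ {n}) using (_∈?_)

  abstract
    fresh : ∀ {m : List (Fin n)} l → Unique m → length l < length m → ∃[ z ] z ∈ m × z ∉ l
    fresh {m} l m! lt with All.all? (_∈? l) m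
    ... | no ¬all = find (¬All⇒Any¬ (_∈? l) m ¬all)
    ... | yes all with complement m! (All.lookup all)
    ... | o , mo↭l = ⊥-elim (<⇒≱ lt (≤-trans (m≤m+n (length m) (length o))
            (≤-reflexive (≡.trans (≡.sym (length-++ m)) (↭-length mo↭l)))))

    fresh-Fin : ∀ (l : List (Fin n)) → length l < n → ∃[ z ] z ∉ l
    fresh-Fin l lt with fresh l (allFin⁺ n) (≤-trans lt (≤-reflexive (≡.sym (length-tabulate (λ i → i)))))
    ... | z , _ , z∉l = z , z∉l

  module _ {G : Graph n} where

    Reach-start : ∀ {ok x y} → Reach G ok x y → ok x
    Reach-start (here k) = k
    Reach-start (step k _ _) = k

    -- When the new start already occurs on the path, the loop is cut off by keeping only the part
    -- from that occurrence on.
    simple-path : ∀ {ok x y} → Reach G ok x y → ∃[ l ] Seg (Edge G) x l y × Unique l × All ok l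
    simple-path (here {x} k) = x ∷ [] , single x , [] ∷ [] , k ∷ []
    simple-path (step {x} k e r) with simple-path r
    ... | l , s , l! , ks with x ∈? l
    ... | no x∉l = x ∷ l , e ∷ s , Unique-∷ x∉l l! , k ∷ ks
    ... | yes x∈l with ∈-∃++ x∈l
    ... | l₁ , l₂ , refl = x ∷ l₂ , proj₂ (Seg-split l₁ s) , drop-Unique l₁ l! , drop-All l₁ ks
      where
      drop-Unique : ∀ l₁ {l₂ : List (Fin n)} → Unique (l₁ ++ l₂) → Unique l₂
      drop-Unique [] u = u
      drop-Unique (_ ∷ l₁) (_ ∷ u) = drop-Unique l₁ u
      drop-All : ∀ l₁ {l₂} {P : Fin n → Set} → All P (l₁ ++ l₂) → All P l₂
      drop-All [] u = u
      drop-All (_ ∷ l₁) (_ ∷ u) = drop-All l₁ u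

    first-exit : ∀ {ok x y} C → Reach G ok x y → x ∈ C → y ∉ C → ∃[ u ] ∃[ z ] u ∈ C × z ∉ C × Edge G u z
    first-exit C (here _) x∈C x∉C = ⊥-elim (x∉C x∈C)
    first-exit C (step {x} {y} _ e r) x∈C y∉C with y ∈? C
    ... | yes y∈C = first-exit C r y∈C y∉C
    ... | no y∉C′ = x , y , x∈C , y∉C′ , e

    -- Returning `ok v` records that the walk avoids `u`, so the ear ends elsewhere than it began.
    first-hit : ∀ {ok x y} C → Reach G ok x y → x ∉ C → y ∈ C →
                ∃[ z ] ∃[ v ] Reach G (_∉ C) x z × Edge G z v × v ∈ C × ok v
    first-hit C (here _) x∉C x∈C = ⊥-elim (x∉C x∈C)
    first-hit C (step {x} {y} _ e r) x∉C z∈C with y ∈? C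
    ... | yes y∈C = x , y , here x∉C , e , y∈C , Reach-start r
    ... | no y∉C with first-hit C r y∉C z∈C
    ... | z , v , path , rest = z , v , step x∉C e path , rest

  Unique-++ : ∀ {r C : List (Fin n)} → Unique r → Unique C → All (_∉ C) r → Unique (r ++ C)
  Unique-++ [] C! [] = C!
  Unique-++ {x ∷ r} {C} (x≢ ∷ r!) C! (x∉C ∷ r∉C) = Unique-∷ x∉ (Unique-++ r! C! r∉C)
    where
    x∉ : x ∉ r ++ C
    x∉ p with ∈-++⁻ r p
    ... | inj₁ q = Unique-head (x≢ ∷ r!) q
    ... | inj₂ q = x∉C q

-- A starting cycle through all heavy vertices, and its extension.

module _ {n : ℕ} (G : Graph n) (2-conn : TwoConnected G) where

  private
    n≥3 : n ≥ 3
    n≥3 = proj₁ 2-conn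

  -- The first step of a walk from `x` to a third vertex that avoids `y`.
  neighbour-avoiding : ∀ {x y} → x ≢ y → ∃[ z ] Edge G x z × z ≢ y
  neighbour-avoiding {x} {y} x≢y with fresh-Fin (x ∷ y ∷ []) n≥3
  ... | t , t∉ with proj₂ (proj₂ 2-conn) y x t x≢y (λ e → t∉ (there (here e)))
  ... | here _ = ⊥-elim (t∉ (here refl))
  ... | step _ e r = _ , e , Reach-start r

  -- A neighbour `z` of `x` other than `y` is joined to `y` by a path avoiding `x`; the given link
  -- closes the cycle, and `z ≢ y` makes its length at least 3.
  cycle-through : ∀ {x y} → x ≢ y → Link G x y →
    ∃[ C ] Unique C × 3 ≤ length C × x ∈ C × y ∈ C × Cyc (Link G) C
  cycle-through {x} {y} x≢y xy with neighbour-avoiding x≢y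
  ... | z , xz , z≢y with simple-path (proj₂ (proj₂ 2-conn) x z y (λ e → edge-≢ G xz (≡.sym e)) (λ e → x≢y (≡.sym e)))
  ... | _ , single _ , _ , _ = ⊥-elim (z≢y refl)
  ... | l , s@(_ ∷ t) , l! , l≢x = x ∷ l ,
        Unique-∷ (λ x∈l → All.lookup l≢x x∈l refl) l! ,
        s≤s (s≤s (Seg-nonempty t)) , here refl , there (end∈ s) ,
        x , y , inj₁ xz ∷ Seg-map inj₁ s , link-sym G xy

  clique-segment : ∀ {x} l → Heavy G x → All (Heavy G) l → ∃[ b ] Heavy G b × Seg (Link G) x (x ∷ l) b
  clique-segment {x} [] hx [] = x , hx , single x
  clique-segment (y ∷ l) hx (hy ∷ hl) with clique-segment l hy hl
  ... | b , hb , s = b , hb , inj₂ (heavy-sum G hx hy) ∷ s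

  -- Heavy vertices are pairwise linked, so three or more form a link cycle in any order; with at
  -- most two, a cycle comes from 2-connectivity.
  heavy-cycle : ∃[ C ] Unique C × 3 ≤ length C × (∀ {z} → Heavy G z → z ∈ C) × Cyc (Link G) C
  heavy-cycle = go (filter heavy? (allFin n)) (filter⁺ heavy? (allFin⁺ n)) (all-filter heavy? (allFin n))
                   (λ {z} hz → ∈-filter⁺ heavy? (∈-allFin z) hz)
    where
    heavy? : ∀ z → Dec (Heavy G z)
    heavy? z = n ≤? 2 * deg G z

    through-neighbour : ∀ x → ∃[ C ] Unique C × 3 ≤ length C × x ∈ C × Cyc (Link G) C
    through-neighbour x with fresh-Fin (x ∷ []) (≤-trans (s≤s (s≤s z≤n)) n≥3)
    ... | t , t∉ with neighbour-avoiding {x} {t} (λ e → t∉ (here (≡.sym e)))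
    ... | y , xy , _ with cycle-through (edge-≢ G xy) (inj₁ xy)
    ... | C , C! , 3≤ , x∈ , _ , cyc = C , C! , 3≤ , x∈ , cyc

    go : ∀ K → Unique K → All (Heavy G) K → (∀ {z} → Heavy G z → z ∈ K) →
         ∃[ C ] Unique C × 3 ≤ length C × (∀ {z} → Heavy G z → z ∈ C) × Cyc (Link G) C
    go [] _ _ ∈K with through-neighbour (proj₁ (fresh-Fin [] (≤-trans (s≤s z≤n) n≥3)))
    ... | C , C! , 3≤ , _ , cyc = C , C! , 3≤ , (λ hz → ⊥-elim (none (∈K hz))) , cyc
      where
      none : ∀ {z : Fin n} → z ∉ []
      none ()
    go (x ∷ []) _ _ ∈K with through-neighbour x
    ... | C , C! , 3≤ , x∈ , cyc = C , C! , 3≤ , (λ hz → sub (∈K hz)) , cyc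
      where
      sub : ∀ {z} → z ∈ x ∷ [] → z ∈ C
      sub (here refl) = x∈
    go (x ∷ y ∷ []) u (hx ∷ hy ∷ []) ∈K
      with cycle-through (λ e → Unique-head u (here e)) (inj₂ (heavy-sum G hx hy))
    ... | C , C! , 3≤ , x∈ , y∈ , cyc = C , C! , 3≤ , (λ hz → sub (∈K hz)) , cyc
      where
      sub : ∀ {z} → z ∈ x ∷ y ∷ [] → z ∈ C
      sub (here refl) = x∈
      sub (there (here refl)) = y∈
    go K@(x ∷ y ∷ z ∷ l) u (hx ∷ hs) ∈K with clique-segment (y ∷ z ∷ l) hx hs
    ... | b , hb , s = K , u , s≤s (s≤s (s≤s z≤n)) , ∈K , x , b , s , inj₂ (heavy-sum G hb hx)

  module _ (o-heavy : OHeavy G)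
    (z2-cond : ∀ a1 a2 a3 b1 c1 → InducedZ2 G a1 a2 a3 b1 c1 → PairCond G a2 b1 × PairCond G a3 b1) where

    -- `k` bounds the number of missing vertices. If no Hamiltonian cycle exists, the induction
    -- refutes every longer link cycle containing `C`; this is the maximality that `no-ear` needs,
    -- which is why the conclusion is doubly negated.
    extend : ∀ k C → Unique C → 3 ≤ length C → (∀ {z} → Heavy G z → z ∈ C) → Cyc (Edge G) C →
             n ≤ k + length C → ¬ ¬ Hamiltonian G
    extend k C C! 3≤C heavy∈C cyc le ¬ham with n ≤? length C
    ... | yes spanning = ¬ham (spanning⇒hamiltonian G C! spanning cyc)
    extend zero C C! 3≤C heavy∈C cyc le ¬ham | no ¬spanning = ¬spanning le
    extend (suc k) C C! 3≤C heavy∈C cyc le ¬ham | no ¬spanning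
      with fresh-Fin C (≰⇒> ¬spanning)
    ... | z , z∉C with first-exit C (proj₁ (proj₂ 2-conn) (proj₁ cyc) z) (start∈ (proj₁ (proj₂ (proj₂ cyc)))) z∉C
    ... | u , x , u∈C , x∉C , ux with fresh (u ∷ []) C! (≤-trans (s≤s (s≤s z≤n)) 3≤C)
    -- A walk from `x` back to the cycle avoiding `u` completes an ear.
    ... | v₀ , v₀∈C , v₀∉u with first-hit C (proj₂ (proj₂ 2-conn) u x v₀ (λ { refl → x∉C u∈C }) (λ e → v₀∉u (here e))) x∉C v₀∈C
    ... | y , v , x⇝y , yv , v∈C , v≢u with simple-path x⇝y
    ... | r , s , r! , r∉C =
      Maximal.no-ear G o-heavy z2-cond C C! 3≤C heavy∈C maximal cyc u∈C v∈C v≢u s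
        (Unique-++ r! C! r∉C) (All.lookup r∉C) ux yv
      where
      maximal : ∀ {l} → Unique l → (∀ {z} → z ∈ C → z ∈ l) → length C < length l → ¬ Cyc (Link G) l
      maximal {l} l! C⊆l lt (a , b , s , e) with reroute G _ s e l! ≤-refl
      ... | t , l′ , l′↭ , l′! , cyc′ = extend k l′ l′! (≤-trans 3≤C (≤-trans (n≤1+n _) longer))
              (λ hz → ∈-resp-↭ (↭-sym l′↭) (∈-++⁺ʳ t (C⊆l (heavy∈C hz)))) cyc′
              (≤-trans le (≤-trans (≤-reflexive (≡.sym (+-suc k (length C)))) (+-monoʳ-≤ k longer))) ¬ham
        where
        longer : length C < length l′
        longer = ≤-trans lt (≤-trans (m≤n+m (length l) (length t))
          (≤-reflexive (≡.trans (≡.sym (length-++ t)) (≡.sym (↭-length l′↭)))))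

theorem10 : ∀ {n : ℕ} (G : Graph n) → n ≥ 3 → TwoConnected G → OHeavy G →
    (∀ a1 a2 a3 b1 c1 → InducedZ2 G a1 a2 a3 b1 c1 →
    PairCond G a2 b1 × PairCond G a3 b1) →
    Hamiltonian G
theorem10 {n} G n≥3 2-conn o-heavy z2-cond with heavy-cycle G 2-conn
... | C , C! , 3≤C , heavy∈C , a , b , s , e with reroute G _ s e C! ≤-refl
-- The crude bound `n` on the missing vertices suffices as fuel.
... | t , l , l↭ , l! , cyc = decidable-stable (hamiltonian? G)
      (extend G 2-conn o-heavy z2-cond n l l!
        (≤-trans 3≤C (≤-trans (m≤n+m (length C) (length t))
          (≤-reflexive (≡.trans (≡.sym (length-++ t)) (≡.sym (↭-length l↭))))))
        (λ hz → ∈-resp-↭ (↭-sym l↭) (∈-++⁺ʳ t (heavy∈C hz))) cyc (m≤m+n n (length l)))
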